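{- For every integer $n\ge 1$, $$\mathrm{pf}_n(132,321)=C_n+\sum_{m=1}^{n-1}(n-m)\,h_{n,m},$$ where $C_n=\frac{1}{n+1}\binom{2n}{n}$ is the $n$th Catalan number and $h_{n,m}$ is the number of Dyck paths of semilength $n$ in which the $m$th north step is immediately followed by an east step.
   Context: A Dyck path of semilength $n$ is a lattice path from $(0,0)$ to $(n,n)$ consisting of $n$ north steps $N=(0,1)$ and $n$ east steps $E=(1,0)$ that never goes below the line $y=x$. A parking function of size $n$ is a Dyck path of semilength $n$ whose $n$ north steps are labeled bijectively by $\{1,\dots,n\}$ so that whenever two north steps are consecutive in the path (one immediately following the other), the label of the later one is larger. For a parking function $p$ of size $n$, $\phi(p)$ is the permutation of $\{1,\dots,n\}$ (in one-line notation) obtained by reading the labels of the north steps in the order they occur along the path. A permutation $\pi$ of $\{1,\dots,n\}$ contains a permutation $\rho$ of $\{1,\dots,m\}$ if there are indices $1\le i_1<\cdots<i_m\le n$ such that $\pi_{i_a}\le\pi_{i_b}$ if and only if $\rho_a\le\rho_b$; otherwise $\pi$ avoids $\rho$. For permutations $\rho_1,\dots,\rho_r$, $\mathrm{pf}_n(\rho_1,\dots,\rho_r)$ denotes the number of parking functions $p$ of size $n$ such that $\phi(p)$ avoids each of $\rho_1,\dots,\rho_r$. North steps of a path are numbered $1,\dots,n$ in the order they occur along the path. -}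

module Defs where

open import Data.Fin as Fin using (Fin)
open import Data.Fin.Patterns using (0F; 1F; 2F)
import Data.Fin.Properties as Fin
open import Data.Fin.Permutation using (Permutation′; permutation; _⟨$⟩ʳ_)
open import Data.List using (List; []; _∷_; _++_; length; map; filter; inits; lookup; allFin; cartesianProductWith)
open import Data.List.Membership.Propositional using (_∈_)
open import Data.List.Membership.Propositional.Properties using (∈-cartesianProductWith⁺)
open import Data.List.Properties using (∷-injective)
open import Data.List.Relation.Unary.All as All using (All; []; _∷_)
open import Data.List.Relation.Unary.AllPairs using ([]; _∷_)
open import Data.List.Relation.Unary.Any using (here)
open import Data.List.Relation.Unary.Linked as Linked using (Linked)
open import Data.List.Relation.Unary.Unique.Propositional using (Unique)
import Data.List.Relation.Unary.Unique.Propositional.Properties as Unique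
open import Data.Nat using (ℕ; zero; suc; _+_; _*_; _≤_; _/_)
open import Data.Nat.Combinatorics using (_C_)
import Data.Nat.Properties as ℕ
open import Data.Product using (∃; ∃-syntax; _×_; _,_)
open import Data.Unit using (⊤; tt)
open import Data.Vec as Vec using (Vec; []; _∷_)
open import Function using (_⇔_; mk⇔; Equivalence)
open import Relation.Binary.Definitions using () renaming (Decidable to Decidable₂)
open import Relation.Binary.PropositionalEquality using (_≡_; refl; cong)
open import Relation.Nullary using (¬_; Dec; yes; no)
open import Relation.Nullary.Decidable using (map′; _×-dec_; _→-dec_; ¬?)
open import Relation.Unary using (Pred; Decidable)
open import Level using (0ℓ)

import Data.List.Membership.DecPropositional as DecMembership
import Data.List.Relation.Unary.Unique.DecPropositional as DecUnique

private
  variable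
    A : Set
    k m n : ℕ

words : List A → ℕ → List (List A)
words as zero    = [] ∷ []
words as (suc k) = cartesianProductWith _∷_ as (words as k)

∈-words : {as w : List A} → All (_∈ as) w → w ∈ words as (length w)
∈-words []          = here refl
∈-words (a∈as ∷ ps) = ∈-cartesianProductWith⁺ _∷_ a∈as (∈-words ps)

words-unique : {as : List A} → Unique as → ∀ k → Unique (words as k)
words-unique as! zero    = [] ∷ []
words-unique as! (suc k) =
  Unique.cartesianProductWith⁺ _∷_ ∷-injective as! (words-unique as! k)

-- Applied below only to enumerations without repetition, so that it counts the
-- words satisfying P.

count : {P : Pred A 0ℓ} → Decidable P → List A → ℕ
count P? xs = length (filter P? xs)

-- The north steps carry labels in A; an unlabelled path is a word over Step ⊤.

data Step (A : Set) : Set where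
  N : A → Step A
  E : Step A

steps : List A → List (Step A)
steps as = E ∷ map N as

norths : List (Step A) → List A
norths []        = []
norths (N a ∷ w) = a ∷ norths w
norths (E ∷ w)   = norths w

#N : List (Step A) → ℕ
#N w = length (norths w)

#E : List (Step A) → ℕ
#E []        = 0
#E (N _ ∷ w) = #E w
#E (E ∷ w)   = suc (#E w)

-- The prefix u of a path ends at the lattice point (#E u , #N u).

IsDyck : ℕ → List (Step A) → Set
IsDyck n w = #E w ≡ n × #N w ≡ n × All (λ u → #E u ≤ #N u) (inits w)

isDyck? : ∀ n → Decidable (IsDyck {A} n)
isDyck? n w = (#E w ℕ.≟ n) ×-dec (#N w ℕ.≟ n) ×-dec All.all? (λ u → #E u ℕ.≤? #N u) (inits w)

-- North steps are numbered from 1.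

NorthThenEast : ℕ → List (Step A) → Set
NorthThenEast m w = ∃[ u ] ∃[ a ] ∃[ v ] w ≡ u ++ N a ∷ E ∷ v × suc (#N u) ≡ m

northThenEast? : ∀ m → Decidable (NorthThenEast {A} m)
northThenEast? m [] = no λ { ([] , _ , _ , () , _) ; (_ ∷ _ , _ , _ , () , _) }
northThenEast? m (E ∷ w) = map′ to from (northThenEast? m w)
  where
  to : NorthThenEast m w → NorthThenEast m (E ∷ w)
  to (u , a , v , refl , eq) = E ∷ u , a , v , refl , eq
  from : NorthThenEast m (E ∷ w) → NorthThenEast m w
  from (E ∷ u , a , v , refl , eq) = u , a , v , refl , eq
northThenEast? 0 (N _ ∷ _) = no λ { (_ , _ , _ , _ , ()) }
northThenEast? 1 (N a ∷ E ∷ w) = yes ([] , a , w , refl , refl)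
northThenEast? 1 (N _ ∷ []) = no λ { ([] , _ , _ , () , _) ; (N _ ∷ _ , _ , _ , _ , ()) }
northThenEast? 1 (N _ ∷ N _ ∷ _) = no λ { ([] , _ , _ , () , _) ; (N _ ∷ _ , _ , _ , _ , ()) }
northThenEast? (suc (suc m)) (N b ∷ w) = map′ to from (northThenEast? (suc m) w)
  where
  to : NorthThenEast (suc m) w → NorthThenEast (suc (suc m)) (N b ∷ w)
  to (u , a , v , refl , eq) = N b ∷ u , a , v , refl , cong suc eq
  from : NorthThenEast (suc (suc m)) (N b ∷ w) → NorthThenEast (suc m) w
  from (N _ ∷ u , a , v , refl , eq) = u , a , v , refl , ℕ.suc-injective eq

-- A Dyck path of semilength n has exactly 2n steps, so filtering the words of
-- that length misses none; likewise for pf.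

h : ℕ → ℕ → ℕ
h n m = count (λ w → isDyck? n w ×-dec northThenEast? m w) (words (steps (tt ∷ [])) (2 * n))

-- The label set {1,…,n} is represented by Fin n, with i standing for i + 1.

ConsecutiveIncreasing : Step (Fin n) → Step (Fin n) → Set
ConsecutiveIncreasing (N i) (N j) = i Fin.< j
ConsecutiveIncreasing _     _     = ⊤

consecutiveIncreasing? : Decidable₂ (ConsecutiveIncreasing {n})
consecutiveIncreasing? (N i) (N j) = i Fin.<? j
consecutiveIncreasing? (N _) E     = yes tt
consecutiveIncreasing? E     _     = yes tt

EachLabelOnce : List (Fin n) → Set
EachLabelOnce xs = Unique xs × (∀ i → i ∈ xs)

eachLabelOnce? : Decidable (EachLabelOnce {n})
eachLabelOnce? xs = unique? xs ×-dec Fin.all? (λ i → i ∈? xs)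
  where
  open DecMembership Fin._≟_ using (_∈?_)
  open DecUnique Fin._≟_ using (unique?)

IsParkingFunction : ∀ n → List (Step (Fin n)) → Set
IsParkingFunction n w =
  IsDyck n w × EachLabelOnce (norths w) × Linked ConsecutiveIncreasing w

isParkingFunction? : ∀ n → Decidable (IsParkingFunction n)
isParkingFunction? n w =
  isDyck? n w ×-dec eachLabelOnce? (norths w) ×-dec Linked.linked? consecutiveIncreasing? w

-- The permutation φ(p) in one-line notation: the labels in path order.

φ : List (Step (Fin n)) → List (Fin n)
φ = norths

IsOccurrence : (π : List (Fin n)) (ρ : Permutation′ k) → Vec (Fin (length π)) k → Set
IsOccurrence π ρ is =
  (∀ a b → a Fin.< b → Vec.lookup is a Fin.< Vec.lookup is b) ×
  (∀ a b → (lookup π (Vec.lookup is a) Fin.≤ lookup π (Vec.lookup is b)) ⇔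
           (ρ ⟨$⟩ʳ a Fin.≤ ρ ⟨$⟩ʳ b))

Contains : List (Fin n) → Permutation′ k → Set
Contains π ρ = ∃ (IsOccurrence π ρ)

Avoids : List (Fin n) → Permutation′ k → Set
Avoids π ρ = ¬ Contains π ρ

private
  _⇔-dec_ : {P Q : Set} → Dec P → Dec Q → Dec (P ⇔ Q)
  p? ⇔-dec q? = map′ (λ (f , g) → mk⇔ f g)
                     (λ e → Equivalence.to e , Equivalence.from e)
                     ((p? →-dec q?) ×-dec (q? →-dec p?))

  anyVec? : ∀ k {P : Pred (Vec (Fin n) k) 0ℓ} → Decidable P → Dec (∃ P)
  anyVec? zero    P? = map′ ([] ,_) (λ { ([] , p) → p }) (P? [])
  anyVec? (suc k) P? =
    map′ (λ (i , is , p) → i ∷ is , p) (λ { (i ∷ is , p) → i , is , p })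
         (Fin.any? λ i → anyVec? k λ is → P? (i ∷ is))

isOccurrence? : (π : List (Fin n)) (ρ : Permutation′ k) → Decidable (IsOccurrence π ρ)
isOccurrence? π ρ is =
  Fin.all? (λ a → Fin.all? λ b →
    (a Fin.<? b) →-dec (Vec.lookup is a Fin.<? Vec.lookup is b))
  ×-dec
  Fin.all? (λ a → Fin.all? λ b →
    (lookup π (Vec.lookup is a) Fin.≤? lookup π (Vec.lookup is b)) ⇔-dec
    ((ρ ⟨$⟩ʳ a) Fin.≤? (ρ ⟨$⟩ʳ b)))

avoids? : (π : List (Fin n)) (ρ : Permutation′ k) → Dec (Avoids π ρ)
avoids? π ρ = ¬? (anyVec? _ (isOccurrence? π ρ))

AvoidsAll : List (Fin n) → List (∃ Permutation′) → Set
AvoidsAll π = All λ (_ , ρ) → Avoids π ρ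

avoidsAll? : (π : List (Fin n)) → Decidable (AvoidsAll π)
avoidsAll? π = All.all? λ (_ , ρ) → avoids? π ρ

pf : ℕ → List (∃ Permutation′) → ℕ
pf n ρs = count (λ w → isParkingFunction? n w ×-dec avoidsAll? (φ w) ρs)
                (words (steps (allFin n)) (2 * n))

-- Both patterns are involutions, so each is its own inverse.

p132 : Permutation′ 3
p132 = permutation f f ff≡id ff≡id
  where
  f : Fin 3 → Fin 3
  f = Vec.lookup (0F ∷ 2F ∷ 1F ∷ [])
  ff≡id : ∀ i → f (f i) ≡ i
  ff≡id 0F = refl
  ff≡id 1F = refl
  ff≡id 2F = refl

p321 : Permutation′ 3
p321 = permutation f f ff≡id ff≡id
  where
  f : Fin 3 → Fin 3
  f = Vec.lookup (2F ∷ 1F ∷ 0F ∷ [])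
  ff≡id : ∀ i → f (f i) ≡ i
  ff≡id 0F = refl
  ff≡id 1F = refl
  ff≡id 2F = refl

-- The division is exact.

catalan : ℕ → ℕ
catalan n = ((2 * n) C n) / suc n

{-# OPTIONS --safe #-}
module Submission where

-- Reading a permutation σ = x τ that avoids 132 and 321, the entries of τ below x form one
-- increasing block, and the entries above x are increasing. So σ is either the identity or
-- B A C, where A B C = 1 2 … n with A and B nonempty; such a σ has its only descent at
-- position m = |B|, and for each m there are n − m choices of |A|. A Dyck path can be labelled
-- by σ iff no two consecutive north steps carry the descent: always for the identity, and iff
-- the mth north step is followed by an east step otherwise. The number of Dyck paths comes
-- from the ballot recursion.

open import Defs
open import Data.Fin as Fin using (Fin)
open import Data.Fin.Patterns using (0F; 1F; 2F)
open import Data.Fin.Permutation using (Permutation′; _⟨$⟩ʳ_)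
import Data.Fin.Properties as Fin
open import Data.List using (List; []; _∷_; _++_; map; filter; length; lookup; take; drop; inits; concatMap; applyUpTo; allFin; cartesianProduct; cartesianProductWith)
open import Data.List.Membership.Propositional using (_∈_; _∉_; find; lose)
open import Data.List.Membership.Propositional.Properties using (∈-++⁺ˡ; ∈-++⁺ʳ; ∈-++⁻; ∈-∃++; ∈-allFin; ∈-applyUpTo⁺; ∈-applyUpTo⁻; ∈-cartesianProduct⁺; ∈-cartesianProduct⁻; ∈-concatMap⁺; ∈-concatMap⁻; ∈-filter⁺; ∈-filter⁻; ∈-lookup; ∈-map⁺; ∈-map⁻)
open import Data.List.Properties using (∷-injectiveˡ; ∷-injectiveʳ; filter-++; filter-none; filter-≐; length-++; length-++-comm; length-applyUpTo; length-drop; length-map; length-tabulate; length-take; map-++; map-∘; take++drop≡id)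
open import Data.List.Relation.Binary.Permutation.Propositional.Properties using (shifts; ∈-resp-↭; ↭-length)
open import Data.List.Relation.Binary.Subset.Propositional using (_⊆_)
open import Data.List.Relation.Unary.All as All using (All; []; _∷_)
import Data.List.Relation.Unary.All.Properties as All
open import Data.List.Relation.Unary.AllPairs as AllPairs using (AllPairs; []; _∷_)
import Data.List.Relation.Unary.AllPairs.Properties as AllPairs
open import Data.List.Relation.Unary.Any using (here; there)
open import Data.List.Relation.Unary.Linked as Linked using (Linked; []; [-]; _∷_)
open import Data.List.Relation.Unary.Linked.Properties using (AllPairs⇒Linked)
open import Data.List.Relation.Unary.Unique.Propositional using (Unique)
import Data.List.Relation.Unary.Unique.Propositional.Properties as Unique
open import Data.Nat using (ℕ; zero; suc; _+_; _*_; _∸_; _/_; _≤_; _<_; z≤n; s≤s)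
open import Data.Nat.Combinatorics using (nCk+nC[k+1]≡[n+1]C[k+1]; k>n⇒nCk≡0) renaming (_C_ to _choose_)
open import Data.Nat.DivMod using (m*n/n≡m)
open import Data.Nat.ListAction using (sum)
open import Data.Nat.ListAction.Properties using (sum-++)
import Data.Nat.Properties as ℕ
open import Data.Nat.Tactic.RingSolver using (solve-∀)
open import Data.Product using (∃; ∃₂; _×_; _,_; proj₁; proj₂; uncurry)
open import Data.Sum using (_⊎_; inj₁; inj₂; [_,_])
open import Data.Unit using (⊤; tt)
open import Data.Vec as Vec using ([]; _∷_)
open import Function using (_∘_; id; _⇔_; mk⇔; Equivalence)
open import Level using (0ℓ)
open import Relation.Binary using (Rel; tri<; tri≈; tri>)
open import Relation.Binary.PropositionalEquality using (_≡_; _≢_; refl; sym; trans; cong; cong₂; subst; subst₂; module ≡-Reasoning)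
open import Relation.Nullary using (¬_; yes; no; contradiction)
open import Relation.Nullary.Decidable using (_×-dec_)
open import Relation.Unary using (Pred; Decidable; _≐_)

-- The counts are lengths of filtered lists of words. Parking functions are sent injectively to
-- pairs of a label word and an unlabelled path, and two duplicate-free lists that include each
-- other have the same length. Hence the avoiders are needed as an explicit list without repetition,
-- indexed by the pair (|A|, |B|), and equal permutations B A C must be shown to come from equal
-- pairs.
--
-- The factor n - m arises because the paths that can carry B A C depend only on where the descent
-- stands: all choices of |A| for a fixed |B| = m contribute the same number of paths.
--
-- The Catalan number is defined by a division, while the ballot recursion yields the difference of
-- C(2n, n) and C(2n, n+1). Absorption of binomial coefficients turns this into n + 1 times the
-- number of Dyck paths being C(2n, n), and only then is the division carried out.

private
  variable
    A B X Y : Set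
    n k m : ℕ

-- Counting by filtered lists

count-map : {P : Pred B 0ℓ} (P? : Decidable P) (f : A → B) (xs : List A) →
            count P? (map f xs) ≡ count (P? ∘ f) xs
count-map P? f [] = refl
count-map P? f (x ∷ xs) with P? (f x)
... | yes _ = cong suc (count-map P? f xs)
... | no  _ = count-map P? f xs

count-++ : {P : Pred A 0ℓ} (P? : Decidable P) (xs ys : List A) →
           count P? (xs ++ ys) ≡ count P? xs + count P? ys
count-++ P? xs ys = trans (cong length (filter-++ P? xs ys)) (length-++ (filter P? xs))

count-cong : {P Q : Pred A 0ℓ} (P? : Decidable P) (Q? : Decidable Q) →
             P ≐ Q → ∀ xs → count P? xs ≡ count Q? xs
count-cong P? Q? P≐Q xs = cong length (filter-≐ P? Q? P≐Q xs)

count-none : {P : Pred A 0ℓ} (P? : Decidable P) → (∀ x → ¬ P x) → ∀ xs → count P? xs ≡ 0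
count-none P? ¬P xs = cong length (filter-none P? (All.universal ¬P xs))

count-product : {P : Pred B 0ℓ} (P? : Decidable P) (f : X → Y → B) (xs : List X) (ys : List Y) →
                count P? (cartesianProductWith f xs ys) ≡
                sum (map (λ x → count (P? ∘ f x) ys) xs)
count-product P? f [] ys = refl
count-product P? f (x ∷ xs) ys =
  trans (count-++ P? (map (f x) ys) _) (cong₂ _+_ (count-map P? (f x) ys) (count-product P? f xs ys))

-- Ballot numbers

-- Subtraction-free form of (k+1) C(n, k+1) = (n - k) C(n, k). Pascal's rule in row n + 1 splits the
-- claim into its instances at k + 1 and k in row n.
nC[1+k]-absorption : ∀ n k → suc k * (n choose suc k) + k * (n choose k) ≡ n * (n choose k)
nC[1+k]-absorption zero zero = refl
nC[1+k]-absorption zero (suc k) = cong₂ _+_ (ℕ.*-zeroʳ (suc (suc k))) (ℕ.*-zeroʳ (suc k))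
nC[1+k]-absorption (suc n) zero = begin
  1 * (suc n choose 1) + 0        ≡⟨ cong (λ c → 1 * c + 0) (nCk+nC[k+1]≡[n+1]C[k+1] n 0) ⟨
  1 * (1 + n choose 1) + 0        ≡⟨ lemma (n choose 1) ⟩
  suc (1 * (n choose 1) + 0)      ≡⟨ cong suc (nC[1+k]-absorption n 0) ⟩
  suc (n * 1)                     ∎
  where
  open ≡-Reasoning
  lemma : ∀ a → 1 * (1 + a) + 0 ≡ suc (1 * a + 0)
  lemma = solve-∀
nC[1+k]-absorption (suc n) (suc k)
  rewrite sym (nCk+nC[k+1]≡[n+1]C[k+1] n (suc k)) | sym (nCk+nC[k+1]≡[n+1]C[k+1] n k) = begin
  suc (suc k) * (b + c) + suc k * (a + b)
    ≡⟨ lemma k a b c ⟩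
  (suc (suc k) * c + suc k * b) + (suc k * b + k * a) + (a + b)
    ≡⟨ cong₂ (λ x y → x + y + (a + b)) (nC[1+k]-absorption n (suc k)) (nC[1+k]-absorption n k) ⟩
  n * b + n * a + (a + b)
    ≡⟨ lemma′ n a b ⟩
  suc n * (a + b) ∎
  where
  open ≡-Reasoning
  a = n choose k
  b = n choose suc k
  c = n choose suc (suc k)
  lemma : ∀ k a b c → suc (suc k) * (b + c) + suc k * (a + b) ≡
          (suc (suc k) * c + suc k * b) + (suc k * b + k * a) + (a + b)
  lemma = solve-∀
  lemma′ : ∀ n a b → n * b + n * a + (a + b) ≡ suc n * (a + b)
  lemma′ = solve-∀

-- How a Dyck path continues from a point at height d above the diagonal.

IsSuffix : ℕ → ℕ → ℕ → List (Step A) → Set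
IsSuffix d a e w = #E w ≡ e × #N w ≡ a × All (λ u → #E u ≤ d + #N u) (inits w)

isSuffix? : ∀ d a e → Decidable (IsSuffix {A} d a e)
isSuffix? d a e w =
  (#E w ℕ.≟ e) ×-dec (#N w ℕ.≟ a) ×-dec All.all? (λ u → #E u ℕ.≤? d + #N u) (inits w)

N-suffix : ∀ d a e (x : A) → (IsSuffix d (suc a) e ∘ (N x ∷_)) ≐ IsSuffix (suc d) a e
N-suffix d a e x =
  (λ (p , q , r) → p , ℕ.suc-injective q ,
     All.map (λ {u} → subst (#E u ≤_) (ℕ.+-suc d (#N u))) (All.map⁻ (All.tail r))) ,
  (λ (p , q , r) → p , cong suc q ,
     z≤n ∷ All.map⁺ (All.map (λ {u} → subst (#E u ≤_) (sym (ℕ.+-suc d (#N u)))) r))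

E-suffix : ∀ d a e → (IsSuffix {A} (suc d) a (suc e) ∘ (E ∷_)) ≐ IsSuffix d a e
E-suffix d a e =
  (λ (p , q , r) → ℕ.suc-injective p , q , All.map ℕ.≤-pred (All.map⁻ (All.tail r))) ,
  (λ (p , q , r) → cong suc p , q , z≤n ∷ All.map⁺ (All.map s≤s r))

¬E-suffix-at-0 : ∀ a e (w : List (Step A)) → ¬ IsSuffix 0 a e (E ∷ w)
¬E-suffix-at-0 a e w (_ , _ , _ ∷ () ∷ _)

steps⊤ : List (Step ⊤)
steps⊤ = steps (tt ∷ [])

count-steps : {P : Pred (List (Step ⊤)) 0ℓ} (P? : Decidable P) (k : ℕ) →
              count P? (words steps⊤ (suc k)) ≡
              count (P? ∘ (E ∷_)) (words steps⊤ k) + count (P? ∘ (N tt ∷_)) (words steps⊤ k)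
count-steps P? k =
  trans (count-product P? _∷_ steps⊤ (words steps⊤ k)) (cong (count (P? ∘ (E ∷_)) (words steps⊤ k) +_) (ℕ.+-identityʳ _))

-- With the reflected term moved to the left, so that no subtraction occurs.
ballot : ∀ k d a → k ≡ a + (a + d) →
         count (isSuffix? d a (a + d)) (words steps⊤ k) + k choose suc (a + d) ≡ k choose a
ballot zero zero zero _ = refl
ballot (suc k) (suc d) zero refl = begin
  count (isSuffix? (suc d) 0 (suc d)) (words steps⊤ (suc k)) + suc k choose suc (suc d)
    ≡⟨ cong₂ _+_ (count-steps (isSuffix? (suc d) 0 (suc d)) k) (k>n⇒nCk≡0 (ℕ.n<1+n (suc d))) ⟩
  count (isSuffix? (suc d) 0 (suc d) ∘ (E ∷_)) ws + count (isSuffix? (suc d) 0 (suc d) ∘ (N tt ∷_)) ws + 0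
    ≡⟨ cong (_+ 0) (cong₂ _+_ (count-cong _ _ (E-suffix d 0 d) ws) (count-none _ (λ { _ (_ , () , _) }) ws)) ⟩
  count (isSuffix? d 0 d) ws + 0 + 0
    ≡⟨ ℕ.+-identityʳ _ ⟩
  count (isSuffix? d 0 d) ws + 0
    ≡⟨ cong (count (isSuffix? d 0 d) ws +_) (k>n⇒nCk≡0 (ℕ.n<1+n d)) ⟨
  count (isSuffix? d 0 d) ws + d choose suc d
    ≡⟨ ballot d d 0 refl ⟩
  1 ∎
  where
  open ≡-Reasoning
  ws = words steps⊤ k
ballot (suc k) zero (suc a) eq = begin
  count (isSuffix? 0 (suc a) (suc a + 0)) (words steps⊤ (suc k)) + suc k choose suc e
    ≡⟨ cong₂ _+_ (count-steps (isSuffix? 0 (suc a) e) k) (sym (nCk+nC[k+1]≡[n+1]C[k+1] k e)) ⟩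
  count (isSuffix? 0 (suc a) e ∘ (E ∷_)) ws + count (isSuffix? 0 (suc a) e ∘ (N tt ∷_)) ws + (k choose e + k choose suc e)
    ≡⟨ cong (_+ (k choose e + k choose suc e)) (cong₂ _+_ (count-none _ (¬E-suffix-at-0 (suc a) e) ws) (count-cong _ _ (N-suffix 0 a e tt) ws)) ⟩
  count (isSuffix? 1 a e) ws + (k choose e + k choose suc e)
    ≡⟨ cong (λ x → count (isSuffix? 1 a x) ws + (k choose e + k choose suc x)) (ℕ.+-suc a 0) ⟨
  count (isSuffix? 1 a (a + 1)) ws + (k choose e + k choose suc (a + 1))
    ≡⟨ lemma (count (isSuffix? 1 a (a + 1)) ws) (k choose e) (k choose suc (a + 1)) ⟩
  count (isSuffix? 1 a (a + 1)) ws + k choose suc (a + 1) + k choose e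
    -- No east step is possible on the diagonal. At height 0 the term `k choose e`, released from
    -- the reflected binomial by Pascal's rule, equals `k choose suc a` and makes up for the missing
    -- branch.
    ≡⟨ cong₂ _+_ (ballot k 1 a (trans (ℕ.suc-injective eq) (cong (a +_) (sym (ℕ.+-suc a 0)))))
         (cong (k choose_) (ℕ.+-identityʳ (suc a))) ⟩
  k choose a + k choose suc a
    ≡⟨ nCk+nC[k+1]≡[n+1]C[k+1] k a ⟩
  suc k choose suc a ∎
  where
  open ≡-Reasoning
  ws = words steps⊤ k
  e = suc a + 0
  lemma : ∀ x y z → x + (y + z) ≡ x + z + y
  lemma = solve-∀
ballot (suc k) (suc d) (suc a) eq = begin
  count (isSuffix? (suc d) (suc a) (suc e)) (words steps⊤ (suc k)) + suc k choose suc (suc e)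
    ≡⟨ cong₂ _+_ (count-steps (isSuffix? (suc d) (suc a) (suc e)) k) (sym (nCk+nC[k+1]≡[n+1]C[k+1] k (suc e))) ⟩
  count (isSuffix? (suc d) (suc a) (suc e) ∘ (E ∷_)) ws + count (isSuffix? (suc d) (suc a) (suc e) ∘ (N tt ∷_)) ws
    + (k choose suc e + k choose suc (suc e))
    ≡⟨ cong (_+ (k choose suc e + k choose suc (suc e))) (cong₂ _+_ (count-cong _ _ (E-suffix d (suc a) e) ws) (count-cong _ _ (N-suffix (suc d) a (suc e) tt) ws)) ⟩
  count (isSuffix? d (suc a) e) ws + count (isSuffix? (suc (suc d)) a (suc e)) ws
    + (k choose suc e + k choose suc (suc e))
    ≡⟨ lemma (count (isSuffix? d (suc a) e) ws) (count (isSuffix? (suc (suc d)) a (suc e)) ws) (k choose suc e) (k choose suc (suc e)) ⟩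
  (count (isSuffix? (suc (suc d)) a (suc e)) ws + k choose suc (suc e))
    + (count (isSuffix? d (suc a) e) ws + k choose suc e)
    ≡⟨ cong₂ _+_
         (subst (λ x → count (isSuffix? (suc (suc d)) a x) ws + k choose suc x ≡ k choose a) e′
           (ballot k (suc (suc d)) a (trans (ℕ.suc-injective eq) (cong (a +_) (sym (ℕ.+-suc a (suc d)))))))
         (subst (λ x → count (isSuffix? d (suc a) x) ws + k choose suc x ≡ k choose suc a) (sym (ℕ.+-suc a d))
           (ballot k d (suc a) (trans (ℕ.suc-injective eq) k-eq))) ⟩
  k choose a + k choose suc a
    ≡⟨ nCk+nC[k+1]≡[n+1]C[k+1] k a ⟩
  suc k choose suc a ∎
  where
  open ≡-Reasoning
  ws = words steps⊤ k
  e = a + suc d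
  e′ : a + suc (suc d) ≡ suc e
  e′ = ℕ.+-suc a (suc d)
  k-eq : a + (suc a + suc d) ≡ suc a + (suc a + d)
  k-eq = solve-k a d
    where
    solve-k : ∀ a d → a + (suc a + suc d) ≡ suc a + (suc a + d)
    solve-k = solve-∀
  lemma : ∀ x y z t → x + y + (z + t) ≡ (y + t) + (x + z)
  lemma = solve-∀

-- Multiplying `#dyck + c ≡ b` by n + 1 and replacing (n+1) c by n b leaves (n+1) `#dyck` = b after
-- cancelling n b, so the quotient in `catalan` is exactly `#dyck`.
count-dyck : ∀ n → count (isDyck? n) (words steps⊤ (2 * n)) ≡ catalan n
count-dyck n = begin
  #dyck                                ≡⟨ m*n/n≡m #dyck (suc n) ⟨
  (#dyck * suc n) / suc n              ≡⟨ cong (_/ suc n) (ℕ.+-cancelʳ-≡ (n * b) _ _ main) ⟩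
  catalan n                            ∎
  where
  open ≡-Reasoning
  #dyck = count (isDyck? n) (words steps⊤ (2 * n))
  b = (2 * n) choose n
  c = (2 * n) choose suc n
  2n≡ : ∀ n → 2 * n ≡ n + (n + 0)
  2n≡ = solve-∀
  reflected : #dyck + c ≡ b
  -- At height 0 `ballot` speaks of `n + 0` east steps; once this is n, `isSuffix? 0 n n` unfolds to
  -- `isDyck? n`.
  reflected = subst (λ e → count (isSuffix? 0 n e) (words steps⊤ (2 * n)) + (2 * n) choose suc e ≡ b)
    (ℕ.+-identityʳ n) (ballot (2 * n) 0 n (2n≡ n))
  ratio : suc n * c ≡ n * b
  ratio = ℕ.+-cancelʳ-≡ (n * b) _ _ (trans (nC[1+k]-absorption (2 * n) n) (lemma n b))
    where
    lemma : ∀ n b → 2 * n * b ≡ n * b + n * b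
    lemma = solve-∀
  main : #dyck * suc n + n * b ≡ b + n * b
  main = begin
    #dyck * suc n + n * b        ≡⟨ cong (#dyck * suc n +_) ratio ⟨
    #dyck * suc n + suc n * c    ≡⟨ lemma #dyck c n ⟩
    suc n * (#dyck + c)          ≡⟨ cong (suc n *_) reflected ⟩
    suc n * b                    ∎
    where
    lemma : ∀ x y n → x * suc n + suc n * y ≡ suc n * (x + y)
    lemma = solve-∀

-- Labelled paths as pairs of a label word and an unlabelled path

⊆-unique⇒length-≤ : {xs ys : List A} → Unique xs → xs ⊆ ys → length xs ≤ length ys
⊆-unique⇒length-≤ {xs = []} _ _ = z≤n
⊆-unique⇒length-≤ {xs = x ∷ xs} (x∉xs ∷ xs!) xs⊆ys with ∈-∃++ (xs⊆ys (here refl))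
... | us , vs , refl =
  subst (suc (length xs) ≤_) (length-++-comm (x ∷ vs) us)
    (s≤s (subst (length xs ≤_) (length-++-comm us vs) (⊆-unique⇒length-≤ xs! xs⊆)))
  where
  xs⊆ : xs ⊆ us ++ vs
  xs⊆ z∈xs with ∈-++⁻ us (xs⊆ys (there z∈xs))
  ... | inj₁ z∈us          = ∈-++⁺ˡ z∈us
  ... | inj₂ (here refl)   = contradiction refl (All.lookup x∉xs z∈xs)
  ... | inj₂ (there z∈vs)  = ∈-++⁺ʳ us z∈vs

length-norths+easts : (w : List (Step A)) → length w ≡ #N w + #E w
length-norths+easts []        = refl
length-norths+easts (N a ∷ w) = cong suc (length-norths+easts w)
length-norths+easts (E ∷ w)   = trans (cong suc (length-norths+easts w)) (sym (ℕ.+-suc (#N w) (#E w)))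

dyck-length : {w : List (Step A)} → IsDyck n w → length w ≡ 2 * n
dyck-length {w = w} (refl , eq , _) =
  trans (length-norths+easts w) (trans (ℕ.+-comm (#N w) (#E w)) (cong (#E w +_) (trans eq (sym (ℕ.+-identityʳ _)))))

∈-steps : {as : List A} → (∀ a → a ∈ as) → ∀ s → s ∈ steps as
∈-steps a∈as (N a) = there (∈-map⁺ N (a∈as a))
∈-steps a∈as E     = here refl

∈-words-steps : {as : List A} → (∀ a → a ∈ as) → {w : List (Step A)} →
                IsDyck n w → w ∈ words (steps as) (2 * n)
∈-words-steps a∈as {w} dyck = subst (λ k → w ∈ words (steps _) k) (dyck-length dyck)
  (∈-words (All.universal (∈-steps a∈as) w))

steps-unique : {as : List A} → Unique as → Unique (steps as)
steps-unique as! = All.map⁺ (All.universal (λ _ ()) _) ∷ Unique.map⁺ (λ { refl → refl }) as!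

shape : List (Step A) → List (Step ⊤)
shape []        = []
shape (N _ ∷ w) = N tt ∷ shape w
shape (E ∷ w)   = E ∷ shape w

-- The path is cut off where the labels run out.
relabel : List A → List (Step B) → List (Step A)
relabel xs       []        = []
relabel xs       (E ∷ w)   = E ∷ relabel xs w
relabel []       (N _ ∷ w) = []
relabel (x ∷ xs) (N _ ∷ w) = N x ∷ relabel xs w

relabel-shape : (w : List (Step A)) → relabel (norths w) (shape w) ≡ w
relabel-shape []        = refl
relabel-shape (N a ∷ w) = cong (N a ∷_) (relabel-shape w)
relabel-shape (E ∷ w)   = cong (E ∷_) (relabel-shape w)

norths-relabel : (xs : List A) (w : List (Step B)) → #N w ≡ length xs → norths (relabel xs w) ≡ xs
norths-relabel []       []        eq = refl
norths-relabel (x ∷ xs) (N _ ∷ w) eq = cong (x ∷_) (norths-relabel xs w (ℕ.suc-injective eq))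
norths-relabel xs       (E ∷ w)   eq = norths-relabel xs w eq

shape-relabel : (xs : List A) (w : List (Step ⊤)) → #N w ≡ length xs → shape (relabel xs w) ≡ w
shape-relabel xs       []         eq = refl
shape-relabel (x ∷ xs) (N tt ∷ w) eq = cong (N tt ∷_) (shape-relabel xs w (ℕ.suc-injective eq))
shape-relabel xs       (E ∷ w)    eq = cong (E ∷_) (shape-relabel xs w eq)

#E-shape : (w : List (Step A)) → #E (shape w) ≡ #E w
#E-shape []        = refl
#E-shape (N _ ∷ w) = #E-shape w
#E-shape (E ∷ w)   = cong suc (#E-shape w)

#N-shape : (w : List (Step A)) → #N (shape w) ≡ #N w
#N-shape []        = refl
#N-shape (N _ ∷ w) = cong suc (#N-shape w)
#N-shape (E ∷ w)   = #N-shape w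

inits-shape : (w : List (Step A)) → inits (shape w) ≡ map shape (inits w)
inits-shape []        = refl
inits-shape (N a ∷ w) = cong ([] ∷_)
  (trans (cong (map (N tt ∷_)) (inits-shape w)) (trans (sym (map-∘ (inits w))) (map-∘ (inits w))))
inits-shape (E ∷ w)   = cong ([] ∷_)
  (trans (cong (map (E ∷_)) (inits-shape w)) (trans (sym (map-∘ (inits w))) (map-∘ (inits w))))

module _ (w : List (Step A)) where

  private
    Above : ∀ {A} → List (Step A) → Set
    Above u = #E u ≤ #N u

  shape-dyck⁺ : IsDyck n w → IsDyck n (shape w)
  shape-dyck⁺ (e , m , above) =
    trans (#E-shape w) e , trans (#N-shape w) m ,
    subst (All Above) (sym (inits-shape w))
      (All.map⁺ (All.map (λ {u} → subst₂ _≤_ (sym (#E-shape u)) (sym (#N-shape u))) above))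

  shape-dyck⁻ : IsDyck n (shape w) → IsDyck n w
  shape-dyck⁻ (e , m , above) =
    trans (sym (#E-shape w)) e , trans (sym (#N-shape w)) m ,
    All.map (λ {u} → subst₂ _≤_ (#E-shape u) (#N-shape u))
      (All.map⁻ (subst (All Above) (inits-shape w) above))

relabel-dyck : (xs : List A) {w : List (Step ⊤)} → length xs ≡ n → IsDyck n w → IsDyck n (relabel xs w)
relabel-dyck xs {w} len dyck@(_ , m , _) = shape-dyck⁻ (relabel xs w)
  (subst (IsDyck _) (sym (shape-relabel xs w (trans m (sym len)))) dyck)

Compatible : List (Fin n) → Pred (List (Step ⊤)) 0ℓ
Compatible {n} σ w = IsDyck n w × Linked ConsecutiveIncreasing (relabel σ w)

compatible? : (σ : List (Fin n)) → Decidable (Compatible σ)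
compatible? {n} σ w = isDyck? n w ×-dec Linked.linked? consecutiveIncreasing? (relabel σ w)

-- A parking function is a pair of a permutation and an unlabelled Dyck path, so
-- summing over the permutations σ that occur leaves the paths compatible with σ.
module _ {P : Pred (List (Fin n)) 0ℓ} (P? : Decidable P) (σs : List (List (Fin n))) (σs! : Unique σs)
         (complete : ∀ {σ} → EachLabelOnce σ → P σ → σ ∈ σs)
         (sound : ∀ {σ} → σ ∈ σs → length σ ≡ n × EachLabelOnce σ × P σ) where

  private
    PF? : Decidable (λ w → IsParkingFunction n w × P (φ w))
    PF? w = isParkingFunction? n w ×-dec P? (φ w)

    labelled : List (List (Step (Fin n)))
    labelled = words (steps (allFin n)) (2 * n)

    unlabelled : List (List (Step ⊤))
    unlabelled = words steps⊤ (2 * n)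

    split : List (Step (Fin n)) → List (Fin n) × List (Step ⊤)
    split w = norths w , shape w

    split-injective : ∀ {w w′} → split w ≡ split w′ → w ≡ w′
    split-injective {w} {w′} eq =
      trans (sym (relabel-shape w)) (trans (cong (uncurry relabel) eq) (relabel-shape w′))

    pairs = filter (uncurry compatible?) (cartesianProduct σs unlabelled)

    split-⊆ : map split (filter PF? labelled) ⊆ pairs
    split-⊆ p∈ with ∈-map⁻ split p∈
    ... | w , w∈ , refl with ∈-filter⁻ PF? {xs = labelled} w∈
    ... | _ , (dyck , once , linked) , Pw = ∈-filter⁺ (uncurry compatible?)
      (∈-cartesianProduct⁺ (complete once Pw) (∈-words-steps (λ _ → here refl) (shape-dyck⁺ w dyck)))
      (shape-dyck⁺ w dyck , subst (Linked _) (sym (relabel-shape w)) linked)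

    pairs-⊆ : pairs ⊆ map split (filter PF? labelled)
    pairs-⊆ {σ , w} p∈ with ∈-filter⁻ (uncurry compatible?) {xs = cartesianProduct σs unlabelled} p∈
    ... | p∈σs×ws , dyck , linked with sound (proj₁ (∈-cartesianProduct⁻ σs unlabelled p∈σs×ws))
    ... | len , once , Pσ = subst (_∈ _) (cong₂ _,_ norths≡ (shape-relabel σ w #N≡))
      (∈-map⁺ split (∈-filter⁺ PF? (∈-words-steps ∈-allFin dyck′)
        ((dyck′ , subst EachLabelOnce (sym norths≡) once , linked) , subst P (sym norths≡) Pσ)))
      where
      #N≡ : #N w ≡ length σ
      #N≡ = trans (proj₁ (proj₂ dyck)) (sym len)
      norths≡ : norths (relabel σ w) ≡ σ
      norths≡ = norths-relabel σ w #N≡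
      dyck′ : IsDyck n (relabel σ w)
      dyck′ = relabel-dyck σ len dyck

  count-parkingFunctions : count PF? labelled ≡ sum (map (λ σ → count (compatible? σ) unlabelled) σs)
  count-parkingFunctions = begin
    length (filter PF? labelled)                ≡⟨ length-map split (filter PF? labelled) ⟨
    length (map split (filter PF? labelled))    ≡⟨ ℕ.≤-antisym
      (⊆-unique⇒length-≤ (Unique.map⁺ split-injective (Unique.filter⁺ PF? (words-unique (steps-unique (Unique.allFin⁺ n)) (2 * n)))) split-⊆)
      (⊆-unique⇒length-≤ (Unique.filter⁺ (uncurry compatible?) (Unique.cartesianProduct⁺ σs! (words-unique (steps-unique ([] ∷ [])) (2 * n)))) pairs-⊆) ⟩
    length pairs                                ≡⟨ count-product (uncurry compatible?) _,_ σs unlabelled ⟩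
    sum (map (λ σ → count (compatible? σ) unlabelled) σs) ∎
    where open ≡-Reasoning

-- Compatibility of a path with a permutation with at most one descent

module _ {n : ℕ} where

  private
    CI = ConsecutiveIncreasing {n}

  E∷⁺ : {w : List (Step (Fin n))} → Linked CI w → Linked CI (E ∷ w)
  E∷⁺ []        = [-]
  E∷⁺ [-]       = tt ∷ [-]
  E∷⁺ (r ∷ rs)  = tt ∷ r ∷ rs

  N∷E∷⁺ : ∀ {i} {w : List (Step (Fin n))} → Linked CI w → Linked CI (N i ∷ E ∷ w)
  N∷E∷⁺ rs = tt ∷ E∷⁺ rs

  increasing-compatible : {σ : List (Fin n)} → Linked Fin._<_ σ → (w : List (Step A)) →
                          Linked CI (relabel σ w)
  increasing-compatible σ↗ []                    = []
  increasing-compatible σ↗ (E ∷ w)               = E∷⁺ (increasing-compatible σ↗ w)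
  increasing-compatible []          (N _ ∷ w)    = []
  increasing-compatible [-]         (N _ ∷ [])   = [-]
  increasing-compatible [-]         (N _ ∷ N _ ∷ w) = [-]
  increasing-compatible (_ ∷ σ↗)    (N _ ∷ [])   = [-]
  increasing-compatible (i<j ∷ σ↗)  (N _ ∷ w@(N _ ∷ _)) = i<j ∷ increasing-compatible σ↗ w
  increasing-compatible [-]         (N _ ∷ E ∷ w) = N∷E∷⁺ (increasing-compatible [] w)
  increasing-compatible (_ ∷ σ↗)    (N _ ∷ E ∷ w) = N∷E∷⁺ (increasing-compatible σ↗ w)

  -- The east step after the last label of `x ∷ xs` separates it from the first label of `σ`, so
  -- nothing is asked of that junction; all other neighbours lie within one of the two increasing
  -- lists.
  descent-compatible⁺ : ∀ {x xs σ} → Linked Fin._<_ (x ∷ xs) → Linked Fin._<_ σ → (w : List (Step A)) →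
                        NorthThenEast (suc (length xs)) w → Linked CI (relabel (x ∷ xs ++ σ) w)
  descent-compatible⁺ xs↗ σ↗ _ (E ∷ u , a , v , refl , eq) =
    E∷⁺ (descent-compatible⁺ xs↗ σ↗ _ (u , a , v , refl , eq))
  descent-compatible⁺ [-] σ↗ _ ([] , a , v , refl , eq) = N∷E∷⁺ (increasing-compatible σ↗ v)
  descent-compatible⁺ [-] σ↗ _ (N _ ∷ _ , a , v , refl , ())
  descent-compatible⁺ (x<y ∷ xs↗) σ↗ _ (N _ ∷ [] , a , v , refl , eq) =
    x<y ∷ descent-compatible⁺ xs↗ σ↗ _ ([] , a , v , refl , ℕ.suc-injective eq)
  descent-compatible⁺ (x<y ∷ xs↗) σ↗ _ (N _ ∷ N b ∷ u , a , v , refl , eq) =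
    x<y ∷ descent-compatible⁺ xs↗ σ↗ _ (N b ∷ u , a , v , refl , ℕ.suc-injective eq)
  descent-compatible⁺ (x<y ∷ xs↗) σ↗ _ (N _ ∷ E ∷ u , a , v , refl , eq) =
    tt ∷ descent-compatible⁺ xs↗ σ↗ _ (E ∷ u , a , v , refl , ℕ.suc-injective eq)

  -- Each north step removes one label until a single `x` stands before `y`. A further north step
  -- there would require x < y, against y < x, and the number of north steps prevents the path from
  -- ending, so an east step follows.
  descent-compatible⁻ : ∀ {x xs y ys} → All (y Fin.<_) (x ∷ xs) → (w : List (Step A)) →
                        #N w ≡ length (x ∷ xs ++ y ∷ ys) → Linked CI (relabel (x ∷ xs ++ y ∷ ys) w) →
                        NorthThenEast (suc (length xs)) w
  descent-compatible⁻ y< (E ∷ w) eq linked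
    with u , a , v , refl , m ← descent-compatible⁻ y< w eq (Linked.tail linked) = E ∷ u , a , v , refl , m
  descent-compatible⁻ {xs = []} y< (N a ∷ E ∷ w) eq linked = [] , a , w , refl , refl
  descent-compatible⁻ {xs = []} (y<x ∷ []) (N a ∷ N _ ∷ w) eq (x<y ∷ _) = contradiction x<y (ℕ.<-asym y<x)
  descent-compatible⁻ {xs = _ ∷ _} (_ ∷ y<) (N b ∷ w) eq linked
    with u , a , v , refl , m ← descent-compatible⁻ y< w (ℕ.suc-injective eq) (Linked.tail linked) =
    N b ∷ u , a , v , refl , cong suc m

-- Lists by positions

lookup⇒All : {P : Pred A 0ℓ} (xs : List A) → (∀ i → P (lookup xs i)) → All P xs
lookup⇒All []       f = []
lookup⇒All (x ∷ xs) f = f Fin.zero ∷ lookup⇒All xs (f ∘ Fin.suc)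

lookup⇒AllPairs : {R : Rel A 0ℓ} (xs : List A) →
                  (∀ i j → i Fin.< j → R (lookup xs i) (lookup xs j)) → AllPairs R xs
lookup⇒AllPairs []       f = []
lookup⇒AllPairs (x ∷ xs) f = lookup⇒All xs (λ j → f Fin.zero (Fin.suc j) (s≤s z≤n)) ∷
                             lookup⇒AllPairs xs (λ i j i<j → f (Fin.suc i) (Fin.suc j) (s≤s i<j))

AllPairs⇒lookup : {R : Rel A 0ℓ} {xs : List A} → AllPairs R xs →
                  ∀ {i j} → i Fin.< j → R (lookup xs i) (lookup xs j)
AllPairs⇒lookup (Rx ∷ _)  {Fin.zero}  {Fin.suc j} _         = All.lookup Rx (∈-lookup j)
AllPairs⇒lookup (_ ∷ Rxs) {Fin.suc i} {Fin.suc j} (s≤s i<j) = AllPairs⇒lookup Rxs i<j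

AllPairs-++⁻ : {R : Rel A 0ℓ} (xs : List A) {ys : List A} → AllPairs R (xs ++ ys) →
               AllPairs R xs × AllPairs R ys × (∀ {x y} → x ∈ xs → y ∈ ys → R x y)
AllPairs-++⁻ []       Rys = [] , Rys , λ ()
AllPairs-++⁻ {R = R} (x ∷ xs) {ys} (Rx ∷ Rs) with AllPairs-++⁻ xs Rs
... | Rxs , Rys , Rxys = All.++⁻ˡ xs Rx ∷ Rxs , Rys , cross
  where
  cross : ∀ {z y} → z ∈ x ∷ xs → y ∈ ys → R z y
  cross (here refl)  y∈ys = All.lookup Rx (∈-++⁺ʳ xs y∈ys)
  cross (there z∈xs) y∈ys = Rxys z∈xs y∈ys

AllPairs-++⁺ : {R : Rel A 0ℓ} {xs ys : List A} → AllPairs R xs → AllPairs R ys →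
               (∀ {x y} → x ∈ xs → y ∈ ys → R x y) → AllPairs R (xs ++ ys)
AllPairs-++⁺ Rxs Rys Rxys = AllPairs.++⁺ Rxs Rys (All.tabulate λ x∈ → All.tabulate (Rxys x∈))

AllPairs-map∈ : {R S : Rel A 0ℓ} {xs : List A} →
                (∀ {x y} → x ∈ xs → y ∈ xs → R x y → S x y) → AllPairs R xs → AllPairs S xs
AllPairs-map∈ f []         = []
AllPairs-map∈ f (Rx ∷ Rxs) = All.tabulate (λ y∈ → f (here refl) (there y∈) (All.lookup Rx y∈)) ∷
                             AllPairs-map∈ (λ x∈ y∈ → f (there x∈) (there y∈)) Rxs

-- Occurrences of 132 and 321 in terms of values

PatternFree : Fin n → Fin n → Fin n → Set
PatternFree x y z = ¬ (x Fin.< z × z Fin.< y) × ¬ (z Fin.< y × y Fin.< x)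

TriplesFree : List (Fin n) → Set
TriplesFree π = ∀ i j k → i Fin.< j → j Fin.< k → PatternFree (lookup π i) (lookup π j) (lookup π k)

module _ (π : List (Fin n)) (ρ : Permutation′ 3) where

  -- `g` lists the three values in increasing order, so the entry at place `a` is `g (ρ a)`. The
  -- order condition on the occurrence thus becomes strict monotonicity of `g`, checked on the nine
  -- pairs.
  occurrence⁺ : ∀ {i j k} → i Fin.< j → j Fin.< k →
                (g : Fin 3 → Fin n) → g 0F Fin.< g 1F → g 1F Fin.< g 2F →
                (∀ a → lookup π (Vec.lookup (i ∷ j ∷ k ∷ []) a) ≡ g (ρ ⟨$⟩ʳ a)) →
                Contains π ρ
  occurrence⁺ {i} {j} {k} i<j j<k g g01 g12 values = i ∷ j ∷ k ∷ [] , positions , λ a b →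
    subst₂ (λ x y → (x Fin.≤ y) ⇔ (ρ ⟨$⟩ʳ a Fin.≤ ρ ⟨$⟩ʳ b)) (sym (values a)) (sym (values b))
      (g-mono (ρ ⟨$⟩ʳ a) (ρ ⟨$⟩ʳ b))
    where
    positions : ∀ a b → a Fin.< b → Vec.lookup (i ∷ j ∷ k ∷ []) a Fin.< Vec.lookup (i ∷ j ∷ k ∷ []) b
    positions 0F 1F _ = i<j
    positions 0F 2F _ = ℕ.<-trans i<j j<k
    positions 1F 2F _ = j<k
    positions 1F 1F (s≤s ())
    positions 2F 1F (s≤s ())
    positions 2F 2F (s≤s (s≤s ()))
    g02 = ℕ.<-trans g01 g12
    both : ∀ {P Q : Set} → P → Q → P ⇔ Q
    both p q = mk⇔ (λ _ → q) (λ _ → p)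
    neither : ∀ {P Q : Set} → ¬ P → ¬ Q → P ⇔ Q
    neither ¬p ¬q = mk⇔ (λ p → contradiction p ¬p) (λ q → contradiction q ¬q)
    g-mono : ∀ a b → (g a Fin.≤ g b) ⇔ (a Fin.≤ b)
    g-mono 0F 0F = both ℕ.≤-refl z≤n
    g-mono 0F 1F = both (ℕ.<⇒≤ g01) z≤n
    g-mono 0F 2F = both (ℕ.<⇒≤ g02) z≤n
    g-mono 1F 0F = neither (ℕ.<⇒≱ g01) λ ()
    g-mono 1F 1F = both ℕ.≤-refl (s≤s z≤n)
    g-mono 1F 2F = both (ℕ.<⇒≤ g12) (s≤s z≤n)
    g-mono 2F 0F = neither (ℕ.<⇒≱ g02) λ ()
    g-mono 2F 1F = neither (ℕ.<⇒≱ g12) λ { (s≤s ()) }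
    g-mono 2F 2F = both ℕ.≤-refl (s≤s (s≤s z≤n))

  -- Occurrences compare values by ≤; the strict comparison is the contrapositive of that
  -- equivalence with `a` and `b` exchanged.
  occurrence⁻ : ∀ is → IsOccurrence π ρ is → ∀ a b → ρ ⟨$⟩ʳ a Fin.< ρ ⟨$⟩ʳ b →
                lookup π (Vec.lookup is a) Fin.< lookup π (Vec.lookup is b)
  occurrence⁻ is (_ , values) a b ρa<ρb =
    ℕ.≰⇒> λ πb≤πa → ℕ.<⇒≱ ρa<ρb (Equivalence.to (values b a) πb≤πa)

patterns : List (∃ Permutation′)
patterns = (3 , p132) ∷ (3 , p321) ∷ []

avoids⇒triplesFree : (π : List (Fin n)) → AvoidsAll π patterns → TriplesFree π
avoids⇒triplesFree π (¬132 ∷ ¬321 ∷ []) i j k i<j j<k =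
  -- In increasing order the values of a 132 stand at positions i, k, j, and those of a 321 at k, j,
  -- i.
  (λ (x<z , z<y) → ¬132 (occurrence⁺ π p132 i<j j<k
     (Vec.lookup (lookup π i ∷ lookup π k ∷ lookup π j ∷ [])) x<z z<y
     λ { 0F → refl ; 1F → refl ; 2F → refl })) ,
  (λ (z<y , y<x) → ¬321 (occurrence⁺ π p321 i<j j<k
     (Vec.lookup (lookup π k ∷ lookup π j ∷ lookup π i ∷ [])) z<y y<x
     λ { 0F → refl ; 1F → refl ; 2F → refl }))

triplesFree⇒avoids : (π : List (Fin n)) → TriplesFree π → AvoidsAll π patterns
triplesFree⇒avoids π free =
  (λ { (is@(i ∷ j ∷ k ∷ []) , occ) → proj₁ (free i j k (proj₁ occ 0F 1F (s≤s z≤n)) (proj₁ occ 1F 2F (s≤s (s≤s z≤n))))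
     (occurrence⁻ π p132 is occ 0F 2F (s≤s z≤n) , occurrence⁻ π p132 is occ 2F 1F (s≤s (s≤s z≤n))) }) ∷
  (λ { (is@(i ∷ j ∷ k ∷ []) , occ) → proj₂ (free i j k (proj₁ occ 0F 1F (s≤s z≤n)) (proj₁ occ 1F 2F (s≤s (s≤s z≤n))))
     (occurrence⁻ π p321 is occ 2F 1F (s≤s z≤n) , occurrence⁻ π p321 is occ 1F 0F (s≤s (s≤s z≤n))) }) ∷ []

-- Strictly increasing lists

Sorted : List (Fin n) → Set
Sorted = AllPairs Fin._<_

-- Each head is the minimum of its list, so the heads agree; strictness keeps a head out of its
-- tail, so both inclusions pass to the tails.
sorted-ext : {xs ys : List (Fin n)} → Sorted xs → Sorted ys →
             (∀ {i} → i ∈ xs → i ∈ ys) → (∀ {i} → i ∈ ys → i ∈ xs) → xs ≡ ys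
sorted-ext [] [] _ _ = refl
sorted-ext [] (_ ∷ _) _ ⊇ with () ← ⊇ (here refl)
sorted-ext (_ ∷ _) [] ⊆ _ with () ← ⊆ (here refl)
sorted-ext {xs = x ∷ xs} {y ∷ ys} (x< ∷ xs↗) (y< ∷ ys↗) ⊆ ⊇ =
  cong₂ _∷_ x≡y (sorted-ext xs↗ ys↗ xs⊆ ys⊆)
  where
  x≡y : x ≡ y
  x≡y with ⊆ (here refl) | ⊇ (here refl)
  ... | here eq   | _         = eq
  ... | there _   | here eq   = sym eq
  ... | there x∈  | there y∈  = contradiction (All.lookup y< x∈) (ℕ.<-asym (All.lookup x< y∈))
  xs⊆ : ∀ {i} → i ∈ xs → i ∈ ys
  xs⊆ i∈ with ⊆ (there i∈)
  ... | there i∈ys = i∈ys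
  ... | here refl  = contradiction (All.lookup x< i∈) (ℕ.<-irrefl (cong Fin.toℕ x≡y))
  ys⊆ : ∀ {i} → i ∈ ys → i ∈ xs
  ys⊆ i∈ with ⊇ (there i∈)
  ... | there i∈xs = i∈xs
  ... | here refl  = contradiction (All.lookup y< i∈) (ℕ.<-irrefl (cong Fin.toℕ (sym x≡y)))

allFin-sorted : ∀ n → Sorted (allFin n)
allFin-sorted n = AllPairs.tabulate⁺-< id

sorted-complete : {xs : List (Fin n)} → Sorted xs → (∀ i → i ∈ xs) → xs ≡ allFin n
sorted-complete xs↗ ∈xs = sorted-ext xs↗ (allFin-sorted _) (λ _ → ∈-allFin _) (λ _ → ∈xs _)

-- Avoiders

module _ {P : Pred A 0ℓ} (P? : Decidable P) where

  split₂ : (xs : List A) → AllPairs (λ x y → ¬ P x → ¬ P y) xs →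
           ∃₂ λ us vs → xs ≡ us ++ vs × All P us × All (¬_ ∘ P) vs
  split₂ [] _ = [] , [] , refl , [] , []
  split₂ (x ∷ xs) (x→ ∷ xs→) with P? x
  ... | no ¬Px = [] , x ∷ xs , refl , [] , ¬Px ∷ All.map (λ f → f ¬Px) x→
  ... | yes Px with us , vs , refl , Pus , ¬Pvs ← split₂ xs xs→ = x ∷ us , vs , refl , Px ∷ Pus , ¬Pvs

  -- Excluding the sequence yes, no, yes makes the entries satisfying `P` contiguous. Once the first
  -- of them is reached, fixing it as the first index leaves exactly the hypothesis of `split₂`.
  split₃ : (xs : List A) →
           (∀ i j k → i Fin.< j → j Fin.< k →
              P (lookup xs i) → ¬ P (lookup xs j) → ¬ P (lookup xs k)) →
           ∃ λ us → ∃₂ λ vs ws →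
             xs ≡ us ++ vs ++ ws × All (¬_ ∘ P) us × All P vs × All (¬_ ∘ P) ws
  split₃ [] _ = [] , [] , [] , refl , [] , [] , []
  split₃ (x ∷ xs) H with P? x
  ... | yes Px with us , vs , refl , Pus , ¬Pvs ← split₂ xs (lookup⇒AllPairs xs λ j k j<k →
                      H Fin.zero (Fin.suc j) (Fin.suc k) (s≤s z≤n) (s≤s j<k) Px) =
    [] , x ∷ us , vs , refl , [] , Px ∷ Pus , ¬Pvs
  ... | no ¬Px with us , vs , ws , refl , ¬Pus , Pvs , ¬Pws ← split₃ xs (λ i j k i<j j<k →
                      H (Fin.suc i) (Fin.suc j) (Fin.suc k) (s≤s i<j) (s≤s j<k)) =
    x ∷ us , vs , ws , refl , ¬Px ∷ ¬Pus , Pvs , ¬Pws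

-- The indices are |A| and |B|, the latter being the position of the descent. The explicit heads
-- make A and B nonempty and name their minima, on which uniqueness and the descent argument rest.
data IsBlock (n : ℕ) : ℕ → ℕ → List (Fin n) → Set where
  block : ∀ a A b B C → (a ∷ A) ++ (b ∷ B) ++ C ≡ allFin n →
          IsBlock n (length (a ∷ A)) (length (b ∷ B)) ((b ∷ B) ++ (a ∷ A) ++ C)

-- The entries of x ∷ τ below x form an increasing block of τ, since an entry above x
-- between two of them would be the 3 of a 132; the entries above x are increasing too.
avoider-structure : (σ : List (Fin n)) → EachLabelOnce σ → TriplesFree σ →
                    σ ≡ allFin n ⊎ ∃₂ λ k m → IsBlock n k m σ
avoider-structure [] (_ , ∈σ) _ = inj₁ (sorted-complete [] ∈σ)
avoider-structure {n} (x ∷ τ) (x∉τ ∷ τ! , ∈σ) free = build (split₃ (Fin._<? x) τ low-high-low)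
  where
  R : Fin n → Fin n → Set
  R y z = (x Fin.< y → x Fin.< z → y Fin.< z) × (y Fin.< x → z Fin.< x → y Fin.< z)

  -- The leading entry `x` completes each inversion to a pattern: it is the 1 of a 132 when both
  -- entries exceed it, and the 3 of a 321 when both are below it.
  R-at : ∀ i j → i Fin.< j → R (lookup τ i) (lookup τ j)
  R-at i j i<j with Fin.<-cmp (lookup τ i) (lookup τ j) | free Fin.zero (Fin.suc i) (Fin.suc j) (s≤s z≤n) (s≤s i<j)
  ... | tri< y<z _ _ | _           = (λ _ _ → y<z) , (λ _ _ → y<z)
  ... | tri≈ _ y≡z _ | _           = contradiction y≡z (AllPairs⇒lookup τ! i<j)
  ... | tri> _ _ z<y | ¬132 , ¬321 = (λ _ x<z → contradiction (x<z , z<y) ¬132) ,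
                                     (λ y<x _ → contradiction (z<y , y<x) ¬321)

  above : ∀ {y} → x ≢ y → ¬ y Fin.< x → x Fin.< y
  above x≢y y≮x = Fin.≤∧≢⇒< (ℕ.≮⇒≥ y≮x) x≢y

  low-high-low : ∀ i j k → i Fin.< j → j Fin.< k →
                 lookup τ i Fin.< x → ¬ lookup τ j Fin.< x → ¬ lookup τ k Fin.< x
  low-high-low i j k i<j j<k a<x d≮x b<x =
    proj₁ (free (Fin.suc i) (Fin.suc j) (Fin.suc k) (s≤s i<j) (s≤s j<k))
      (proj₂ (R-at i k (ℕ.<-trans i<j j<k)) a<x b<x ,
       ℕ.<-trans b<x (above (AllPairs⇒lookup (x∉τ ∷ τ!) {Fin.zero} {Fin.suc j} (s≤s z≤n)) d≮x))

  build : (∃ λ us → ∃₂ λ vs ws → τ ≡ us ++ vs ++ ws ×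
             All (λ y → ¬ y Fin.< x) us × All (Fin._< x) vs × All (λ y → ¬ y Fin.< x) ws) →
          x ∷ τ ≡ allFin n ⊎ ∃₂ λ k m → IsBlock n k m (x ∷ τ)
  build (us , vs , ws , refl , us≮x , vs<x , ws≮x) = conclude vs sorted
    where
    R-τ : AllPairs R τ
    R-τ = lookup⇒AllPairs τ R-at
    R-vs++ws : AllPairs R (vs ++ ws)
    R-vs++ws = proj₁ (proj₂ (AllPairs-++⁻ us R-τ))
    R-us : AllPairs R us
    R-us = proj₁ (AllPairs-++⁻ us R-τ)
    R-vs : AllPairs R vs
    R-vs = proj₁ (AllPairs-++⁻ vs R-vs++ws)
    R-ws : AllPairs R ws
    R-ws = proj₁ (proj₂ (AllPairs-++⁻ vs R-vs++ws))
    R-us-ws : ∀ {y z} → y ∈ us → z ∈ ws → R y z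
    R-us-ws y∈ z∈ = proj₂ (proj₂ (AllPairs-++⁻ us R-τ)) y∈ (∈-++⁺ʳ vs z∈)
    x<us : ∀ {y} → y ∈ us → x Fin.< y
    x<us y∈ = above (All.lookup x∉τ (∈-++⁺ˡ y∈)) (All.lookup us≮x y∈)
    x<ws : ∀ {y} → y ∈ ws → x Fin.< y
    x<ws y∈ = above (All.lookup x∉τ (∈-++⁺ʳ us (∈-++⁺ʳ vs y∈))) (All.lookup ws≮x y∈)
    us++ws↗ : Sorted (us ++ ws)
    us++ws↗ = AllPairs-++⁺
      (AllPairs-map∈ {R = R} (λ y∈ z∈ r → proj₁ r (x<us y∈) (x<us z∈)) R-us)
      (AllPairs-map∈ {R = R} (λ y∈ z∈ r → proj₁ r (x<ws y∈) (x<ws z∈)) R-ws)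
      (λ y∈ z∈ → proj₁ (R-us-ws y∈ z∈) (x<us y∈) (x<ws z∈))
    x<us++ws : All (x Fin.<_) (us ++ ws)
    x<us++ws = All.++⁺ (All.tabulate x<us) (All.tabulate x<ws)
    x≤ : ∀ {y} → y ∈ x ∷ us ++ ws → x Fin.≤ y
    x≤ (here refl) = ℕ.≤-refl
    x≤ (there y∈)  = ℕ.<⇒≤ (All.lookup x<us++ws y∈)
    -- In the block notation `vs` is A, `x ∷ us` is B and `ws` is C; an empty `vs` gives the
    -- identity.
    sorted : vs ++ (x ∷ us) ++ ws ≡ allFin n
    sorted = sorted-complete
      (AllPairs-++⁺
        (AllPairs-map∈ {R = R} (λ y∈ z∈ r → proj₂ r (All.lookup vs<x y∈) (All.lookup vs<x z∈)) R-vs)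
        (x<us++ws ∷ us++ws↗)
        (λ y∈ z∈ → ℕ.<-≤-trans (All.lookup vs<x y∈) (x≤ z∈)))
      (λ i → ∈-resp-↭ (shifts (x ∷ us) vs) (∈σ i))
    conclude : ∀ vs → vs ++ (x ∷ us) ++ ws ≡ allFin n →
               (x ∷ us) ++ vs ++ ws ≡ allFin n ⊎ ∃₂ λ k m → IsBlock n k m ((x ∷ us) ++ vs ++ ws)
    conclude []       eq = inj₁ eq
    conclude (v ∷ vs) eq = inj₂ (_ , _ , block v vs x us ws eq)

-- Exchanging two adjacent blocks creates neither pattern

module _ (A B C : List (Fin n)) (split : A ++ B ++ C ≡ allFin n) where

  private
    A++B++C↗ : Sorted (A ++ B ++ C)
    A++B++C↗ = subst Sorted (sym split) (allFin-sorted n)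

    A<B++C : ∀ {x y} → x ∈ A → y ∈ B ++ C → x Fin.< y
    A<B++C = proj₂ (proj₂ (AllPairs-++⁻ A A++B++C↗))

    B<C : ∀ {x y} → x ∈ B → y ∈ C → x Fin.< y
    B<C = proj₂ (proj₂ (AllPairs-++⁻ B (proj₁ (proj₂ (AllPairs-++⁻ A A++B++C↗)))))

  first-sorted : Sorted A
  first-sorted = proj₁ (AllPairs-++⁻ A A++B++C↗)

  second-sorted : Sorted B
  second-sorted = proj₁ (AllPairs-++⁻ B (proj₁ (proj₂ (AllPairs-++⁻ A A++B++C↗))))

  first<second : ∀ {x y} → x ∈ A → y ∈ B → x Fin.< y
  first<second x∈ y∈ = A<B++C x∈ (∈-++⁺ˡ y∈)

  first++third-sorted : Sorted (A ++ C)
  first++third-sorted = AllPairs-++⁺ first-sorted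
    (proj₁ (proj₂ (AllPairs-++⁻ B (proj₁ (proj₂ (AllPairs-++⁻ A A++B++C↗))))))
    (λ x∈ y∈ → A<B++C x∈ (∈-++⁺ʳ B y∈))

  private
    -- What holds between any entry y of B A C and any later entry z. It records two facts: an
    -- inversion goes from B to A, and everything before an entry of B is itself in B.
    Rel-BAC : Fin n → Fin n → Set
    Rel-BAC y z = (y Fin.< z × (z ∈ B → y ∈ B)) ⊎ (y ∈ B × z ∈ A)

    B∩AC=∅ : ∀ {x} → x ∈ A ++ C → x ∉ B
    B∩AC=∅ x∈ x∈B with ∈-++⁻ A x∈
    ... | inj₁ x∈A = ℕ.<-irrefl refl (first<second x∈A x∈B)
    ... | inj₂ x∈C = ℕ.<-irrefl refl (B<C x∈B x∈C)

    related : AllPairs Rel-BAC (B ++ A ++ C)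
    related = AllPairs-++⁺
      (AllPairs-map∈ (λ y∈ _ y<z → inj₁ (y<z , λ _ → y∈)) second-sorted)
      (AllPairs-map∈ (λ _ z∈ y<z → inj₁ (y<z , λ z∈B → contradiction z∈B (B∩AC=∅ z∈))) first++third-sorted)
      (λ y∈ z∈ → [ (λ z∈A → inj₂ (y∈ , z∈A)) , (λ z∈C → inj₁ (B<C y∈ z∈C , λ _ → y∈)) ] (∈-++⁻ A z∈))

    inversion : ∀ {y z} → Rel-BAC y z → z Fin.< y → y ∈ B × z ∈ A
    inversion (inj₁ (y<z , _)) z<y = contradiction z<y (ℕ.<-asym y<z)
    inversion (inj₂ p)         _   = p

    before-B : ∀ {y z} → Rel-BAC y z → z ∈ B → y ∈ B
    before-B (inj₁ (_ , f))   z∈B = f z∈B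
    before-B (inj₂ (y∈B , _)) _   = y∈B

  swap-once : EachLabelOnce (B ++ A ++ C)
  swap-once = AllPairs.map distinct related ,
    λ i → ∈-resp-↭ (shifts A B) (subst (i ∈_) (sym split) (∈-allFin i))
    where
    distinct : ∀ {y z} → Rel-BAC y z → y ≢ z
    distinct (inj₁ (y<z , _)) refl = ℕ.<-irrefl refl y<z
    distinct (inj₂ (y∈B , z∈A)) refl = ℕ.<-irrefl refl (first<second z∈A y∈B)

  swap-length : length (B ++ A ++ C) ≡ n
  swap-length = trans (↭-length (shifts B A)) (trans (cong length split) (length-tabulate id))

  -- The inversion ending a 132 would put its 3 in B and its 2 in A, hence the earlier 1 in B and so
  -- above the 2. The middle entry of a 321 would lie in both A and B.
  swap-avoids : AvoidsAll (B ++ A ++ C) patterns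
  swap-avoids = triplesFree⇒avoids (B ++ A ++ C) λ i j k i<j j<k →
    (λ (x<z , z<y) →
      let y∈B , z∈A = inversion (AllPairs⇒lookup related j<k) z<y
          x∈B       = before-B (AllPairs⇒lookup related i<j) y∈B
      in ℕ.<-asym x<z (first<second z∈A x∈B)) ,
    (λ (z<y , y<x) →
      let _ , y∈A = inversion (AllPairs⇒lookup related i<j) y<x
          y∈B , _ = inversion (AllPairs⇒lookup related j<k) z<y
      in ℕ.<-irrefl refl (first<second y∈A y∈B))

-- Blocks determined by their lengths

++-cancel-at : ∀ {x : A} us us′ {vs vs′} → x ∉ us → x ∉ us′ →
               us ++ x ∷ vs ≡ us′ ++ x ∷ vs′ → us ≡ us′
++-cancel-at []       []         _ _ _  = refl
++-cancel-at []       (_ ∷ _)    _ x∉us′ eq = contradiction (here (∷-injectiveˡ eq)) x∉us′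
++-cancel-at (_ ∷ _)  []         x∉us _ eq = contradiction (here (sym (∷-injectiveˡ eq))) x∉us
++-cancel-at (u ∷ us) (u′ ∷ us′) x∉us x∉us′ eq =
  cong₂ _∷_ (∷-injectiveˡ eq) (++-cancel-at us us′ (x∉us ∘ there) (x∉us′ ∘ there) (∷-injectiveʳ eq))

take-length-++ : (xs : List A) {ys : List A} → take (length xs) (xs ++ ys) ≡ xs
take-length-++ []       = refl
take-length-++ (x ∷ xs) = cong (x ∷_) (take-length-++ xs)

drop-length-++ : (xs : List A) {ys : List A} → drop (length xs) (xs ++ ys) ≡ ys
drop-length-++ []       = refl
drop-length-++ (x ∷ xs) = drop-length-++ xs

-- A is the first k entries and B the next m; describing the exchange by lengths alone allows the
-- avoiders to be listed by pairs of numbers.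
swapBlocks : ℕ → ℕ → List A → List A
swapBlocks k m xs = take m (drop k xs) ++ take k xs ++ drop m (drop k xs)

block⇒swapBlocks : ∀ {σ} → IsBlock n k m σ → σ ≡ swapBlocks k m (allFin n)
block⇒swapBlocks (block a A b B C eq)
  rewrite sym eq | take-length-++ A {b ∷ B ++ C} | drop-length-++ A {b ∷ B ++ C}
        | take-length-++ B {C} | drop-length-++ B {C} = refl

swapBlocks-block : suc k + suc m ≤ n → IsBlock n (suc k) (suc m) (swapBlocks (suc k) (suc m) (allFin n))
swapBlocks-block {k} {m} {n} k+m≤n = build (take (suc k) (allFin n)) (take (suc m) rest) (drop (suc m) rest) split
  (lengthOf (suc k) (allFin n) k≤) (lengthOf (suc m) rest m≤)
  where
  rest = drop (suc k) (allFin n)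
  split : take (suc k) (allFin n) ++ take (suc m) rest ++ drop (suc m) rest ≡ allFin n
  split = trans (cong (take (suc k) (allFin n) ++_) (take++drop≡id (suc m) rest)) (take++drop≡id (suc k) (allFin n))
  lengthOf : ∀ j (xs : List (Fin n)) → j ≤ length xs → length (take j xs) ≡ j
  lengthOf j xs j≤ = trans (length-take j xs) (ℕ.m≤n⇒m⊓n≡m j≤)
  k≤ : suc k ≤ length (allFin n)
  k≤ = subst (suc k ≤_) (sym (length-tabulate id)) (ℕ.m+n≤o⇒m≤o (suc k) k+m≤n)
  m≤ : suc m ≤ length rest
  m≤ = subst (suc m ≤_) (sym (trans (length-drop (suc k) (allFin n)) (cong (_∸ suc k) (length-tabulate {n = n} id))))
    (ℕ.m+n≤o⇒m≤o∸n (suc m) (subst (_≤ n) (ℕ.+-comm (suc k) (suc m)) k+m≤n))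
  -- The three pieces are generalized to variables so that matching on the length equations exposes
  -- the heads of A and B.
  build : ∀ A B C → A ++ B ++ C ≡ allFin n → length A ≡ suc k → length B ≡ suc m →
          IsBlock n (suc k) (suc m) (B ++ A ++ C)
  build (a ∷ A) (b ∷ B) C eq refl refl = block a A b B C eq

block-size : ∀ {σ} → IsBlock n k m σ → 1 ≤ k × 1 ≤ m × k + m ≤ n
block-size {n} (block a A b B C eq) = s≤s z≤n , s≤s z≤n ,
  subst (length (a ∷ A) + length (b ∷ B) ≤_)
    (trans (sym (trans (length-++ (a ∷ A)) (cong (length (a ∷ A) +_) (length-++ (b ∷ B)))))
      (trans (cong length eq) (length-tabulate id)))
    (ℕ.+-monoʳ-≤ (length (a ∷ A)) (ℕ.m≤m+n (length (b ∷ B)) (length C)))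

-- A and B both start with their minimum, so B ends at the first entry of A in B ++ A ++ C
-- and A ends at the first entry of B in A ++ B ++ C.
block-unique : ∀ {k′ m′ σ} → IsBlock n k m σ → IsBlock n k′ m′ σ → k ≡ k′ × m ≡ m′
block-unique {n} bl bl′ = go bl bl′ refl
  where
  go : ∀ {k m k′ m′ σ σ′} → IsBlock n k m σ → IsBlock n k′ m′ σ′ → σ ≡ σ′ → k ≡ k′ × m ≡ m′
  go (block a A b B C eq) (block a′ A′ b′ B′ C′ eq′) σ≡σ′
    with refl ← ∷-injectiveˡ (trans eq (sym eq′)) | refl ← ∷-injectiveˡ σ≡σ′ =
    cong length A≡A′ , cong length B≡B′
    where
    a∉ : ∀ {a b A B C} → (a ∷ A) ++ (b ∷ B) ++ C ≡ allFin n → a ∉ b ∷ B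
    a∉ {a} {b} {A} {B} {C} eq a∈ = ℕ.<-irrefl refl (first<second (a ∷ A) (b ∷ B) C eq (here refl) a∈)
    b∉ : ∀ {a b A B C} → (a ∷ A) ++ (b ∷ B) ++ C ≡ allFin n → b ∉ a ∷ A
    b∉ {a} {b} {A} {B} {C} eq b∈ = ℕ.<-irrefl refl (first<second (a ∷ A) (b ∷ B) C eq b∈ (here refl))
    A≡A′ : a ∷ A ≡ a ∷ A′
    A≡A′ = ++-cancel-at (a ∷ A) (a ∷ A′) (b∉ {A = A} {B} {C} eq) (b∉ {A = A′} {B′} {C′} eq′) (trans eq (sym eq′))
    B≡B′ : b ∷ B ≡ b ∷ B′
    B≡B′ = ++-cancel-at (b ∷ B) (b ∷ B′) (a∉ {A = A} {B} {C} eq) (a∉ {A = A′} {B′} {C′} eq′) σ≡σ′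

-- The two lists begin with the heads of B and of A, and the head of A is smaller.
block≢allFin : ∀ {σ} → IsBlock n k m σ → allFin n ≢ σ
block≢allFin (block a A b B C eq) allFin≡ with refl ← ∷-injectiveˡ (trans eq allFin≡) =
  ℕ.<-irrefl refl (first<second (a ∷ A) (b ∷ B) C eq (here refl) (here refl))

-- B and A C are increasing, and `a`, which opens A C, lies below all of B, so the descent stands
-- right after the m entries of B.
block-compatible : ∀ {σ} → IsBlock n k m σ →
                   Compatible σ ≐
                   (λ w → IsDyck n w × NorthThenEast m w)
block-compatible {n} (block a A b B C eq) =
  (λ {w} (dyck@(_ , #N≡n , _) , linked) → dyck ,
     descent-compatible⁻ (All.tabulate (first<second (a ∷ A) (b ∷ B) C eq (here refl))) w
       (trans #N≡n (sym (swap-length (a ∷ A) (b ∷ B) C eq))) linked) ,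
  (λ {w} (dyck , ne) → dyck ,
     descent-compatible⁺ (AllPairs⇒Linked (second-sorted (a ∷ A) (b ∷ B) C eq))
       (AllPairs⇒Linked (first++third-sorted (a ∷ A) (b ∷ B) C eq)) w ne)

-- The list of avoiders

swaps : ∀ n → ℕ → List (List (Fin n))
swaps n m = map (λ k → swapBlocks k m (allFin n)) (applyUpTo suc (n ∸ m))

-- Arranged like the formula: the identity first, then for each m from 1 to n - 1 the n - m
-- exchanges with |B| = m. Here `applyUpTo suc j` is the list 1, ..., j.
avoiders : ∀ n → List (List (Fin n))
avoiders n = allFin n ∷ concatMap (swaps n) (applyUpTo suc (n ∸ 1))

∈-range : m ∈ applyUpTo suc n → ∃ λ i → m ≡ suc i × i < n
∈-range m∈ with i , i<n , eq ← ∈-applyUpTo⁻ suc m∈ = i , eq , i<n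

range-block : m ∈ applyUpTo suc (n ∸ 1) → k ∈ applyUpTo suc (n ∸ m) →
              IsBlock n k m (swapBlocks k m (allFin n))
range-block {n = n} m∈ k∈
  with i , refl , i< ← ∈-range m∈ | j , refl , j< ← ∈-range k∈ =
  swapBlocks-block (ℕ.m≤o∸n⇒m+n≤o (suc j) (ℕ.≤-trans i< (ℕ.m∸n≤m n 1)) j<)

swaps-block : ∀ {σ} → m ∈ applyUpTo suc (n ∸ 1) → σ ∈ swaps n m → ∃ λ k → IsBlock n k m σ
swaps-block m∈ σ∈ with k , k∈ , refl ← ∈-map⁻ _ σ∈ = k , range-block m∈ k∈

range-unique : ∀ n → Unique (applyUpTo suc n)
range-unique n = Unique.applyUpTo⁺₁ suc n (λ i<j _ → ℕ.<⇒≢ i<j ∘ ℕ.suc-injective)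

-- By `block-unique`, k separates the entries within one `swaps n m`, and m separates the lists for
-- different m.
avoiders-unique : ∀ n → Unique (avoiders n)
avoiders-unique n = All.tabulate fresh ∷ Unique.concat⁺
  (All.map⁺ (All.tabulate λ {m} m∈ → AllPairs.map⁺ (AllPairs-map∈
    (λ k∈ k′∈ k≢k′ eq → k≢k′ (proj₁ (block-unique (range-block m∈ k∈) (subst (IsBlock n _ _) (sym eq) (range-block m∈ k′∈)))))
    (range-unique (n ∸ m)))))
  (AllPairs.map⁺ (AllPairs-map∈
    (λ m∈ m′∈ m≢m′ (σ∈ , σ∈′) → m≢m′ (proj₂ (block-unique (proj₂ (swaps-block m∈ σ∈)) (proj₂ (swaps-block m′∈ σ∈′)))))
    (range-unique (n ∸ 1))))
  where
  fresh : ∀ {σ} → σ ∈ concatMap (swaps n) (applyUpTo suc (n ∸ 1)) → allFin n ≢ σ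
  fresh σ∈ with m , m∈ , σ∈swaps ← find (∈-concatMap⁻ (swaps n) σ∈) = block≢allFin (proj₂ (swaps-block m∈ σ∈swaps))

∈-range⁺ : 1 ≤ m → m ≤ n → m ∈ applyUpTo suc n
∈-range⁺ (s≤s _) m≤n = ∈-applyUpTo⁺ suc m≤n

avoiders-complete : ∀ {σ} → EachLabelOnce σ → AvoidsAll σ patterns → σ ∈ avoiders n
avoiders-complete {n} {σ} once avoids with avoider-structure σ once (avoids⇒triplesFree σ avoids)
... | inj₁ refl = here refl
... | inj₂ (k , m , bl) with 1≤k , 1≤m , k+m≤n ← block-size bl =
  there (∈-concatMap⁺ (swaps n) (lose (∈-range⁺ 1≤m m≤n∸1)
    (subst (_∈ swaps n m) (sym (block⇒swapBlocks bl)) (∈-map⁺ _ (∈-range⁺ 1≤k (ℕ.m+n≤o⇒m≤o∸n k k+m≤n))))))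
  where
  m≤n∸1 : m ≤ n ∸ 1
  -- A is nonempty, so 1 + m ≤ k + m ≤ n.
  m≤n∸1 = ℕ.m+n≤o⇒m≤o∸n m (subst (_≤ n) (ℕ.+-comm 1 m) (ℕ.≤-trans (ℕ.+-monoˡ-≤ m 1≤k) k+m≤n))

avoiders-sound : ∀ {σ} → σ ∈ avoiders n → length σ ≡ n × EachLabelOnce σ × AvoidsAll σ patterns
avoiders-sound {n} (here refl) =
  -- The identity is the exchange of two empty blocks.
  swap-length [] [] (allFin n) refl , swap-once [] [] (allFin n) refl , swap-avoids [] [] (allFin n) refl
avoiders-sound {n} (there σ∈) with m , m∈ , σ∈swaps ← find (∈-concatMap⁻ (swaps n) σ∈)
  with _ , block a A b B C eq ← swaps-block m∈ σ∈swaps =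
  swap-length (a ∷ A) (b ∷ B) C eq , swap-once (a ∷ A) (b ∷ B) C eq , swap-avoids (a ∷ A) (b ∷ B) C eq

-- Summation over the avoiders

sum-map-const : (f : A → ℕ) (c : ℕ) (xs : List A) → (∀ {x} → x ∈ xs → f x ≡ c) →
                sum (map f xs) ≡ length xs * c
sum-map-const f c []       f≡c = refl
sum-map-const f c (x ∷ xs) f≡c = cong₂ _+_ (f≡c (here refl)) (sum-map-const f c xs (f≡c ∘ there))

sum-map-concatMap : (f : B → ℕ) (g : A → List B) (s : A → ℕ) (xs : List A) →
                    (∀ {x} → x ∈ xs → sum (map f (g x)) ≡ s x) →
                    sum (map f (concatMap g xs)) ≡ sum (map s xs)
sum-map-concatMap f g s []       sums = refl
sum-map-concatMap f g s (x ∷ xs) sums = begin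
  sum (map f (g x ++ concatMap g xs))               ≡⟨ cong sum (map-++ f (g x) (concatMap g xs)) ⟩
  sum (map f (g x) ++ map f (concatMap g xs))       ≡⟨ sum-++ (map f (g x)) _ ⟩
  sum (map f (g x)) + sum (map f (concatMap g xs))  ≡⟨ cong₂ _+_ (sums (here refl)) (sum-map-concatMap f g s xs (sums ∘ there)) ⟩
  s x + sum (map s xs)                              ∎
  where open ≡-Reasoning

theorem24 : (n : ℕ) → 1 ≤ n →
    pf n ((3 , p132) ∷ (3 , p321) ∷ []) ≡
    catalan n + sum (map (λ m → (n ∸ m) * h n m) (applyUpTo suc (n ∸ 1)))
theorem24 n _ = trans
  (count-parkingFunctions avoids-patterns? (avoiders n) (avoiders-unique n) avoiders-complete avoiders-sound)
  (cong₂ _+_ identity (sum-map-concatMap paths (swaps n) _ (applyUpTo suc (n ∸ 1)) descent-at))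
  where
  avoids-patterns? = λ (σ : List (Fin n)) → avoidsAll? σ patterns

  ws = words steps⊤ (2 * n)

  paths : List (Fin n) → ℕ
  paths σ = count (compatible? σ) ws

  identity : paths (allFin n) ≡ catalan n
  identity = trans
    (count-cong _ (isDyck? n) (proj₁ , λ {w} dyck → dyck , increasing-compatible (AllPairs⇒Linked (allFin-sorted n)) w) ws)
    (count-dyck n)

  descent-at : ∀ {m} → m ∈ applyUpTo suc (n ∸ 1) → sum (map paths (swaps n m)) ≡ (n ∸ m) * h n m
  descent-at {m} m∈ = trans
    (sum-map-const paths (h n m) (swaps n m) λ σ∈ →
      count-cong _ (λ w → isDyck? n w ×-dec northThenEast? m w) (block-compatible (proj₂ (swaps-block m∈ σ∈))) ws)
    (cong (_* h n m) (trans (length-map _ (applyUpTo suc (n ∸ m))) (length-applyUpTo suc (n ∸ m))))
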